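{- Let $n$ be a positive integer and $g=3n+1$. Then the image under $\sigma$ of $\mathcal{G}_{2n}(g,q\le 3)$ contains no pseudo-symmetric gapset, and in fact $$\sigma\big(\mathcal{G}_{2n}(g,q\le 3)\big)=\mathcal{G}_{2n+1}(g+1)\setminus\mathcal{P},$$ where $\mathcal{P}=\{G\in\mathcal{G}_{2n+1}(g+1): G \text{ is pseudo-symmetric}\}$.
   Context: A gapset is a finite set $G\subset\mathbb{N}=\{1,2,\dots\}$ such that whenever $z\in G$ and $z=x+y$ with $x,y\in\mathbb{N}$, then $x\in G$ or $y\in G$; its genus is $g=\#G$. Write $G=\{\ell_1<\dots<\ell_g\}$. The multiplicity is $m(G)=\min\{s\in\mathbb{N}:s\notin G\}$, the conductor $c(G)=\min\{s\in\mathbb{N}: s+t\notin G\ \forall t\in\mathbb{N}_0\}$, the Frobenius number $F(G)=c(G)-1$ (equal to $\ell_g$ for nonempty $G$), and the depth $q(G)=\lceil c(G)/m(G)\rceil$. $G$ is pseudo-symmetric if $F(G)=2g-2$. $G$ is pure $\kappa$-sparse if $\ell_{i+1}-\ell_i\le\kappa$ for all $i$ with equality for at least one $i$. $\mathcal{G}_\kappa(g)$ is the set of pure $\kappa$-sparse gapsets of genus $g$, and $\mathcal{G}_\kappa(g,q\le 3)$ the subset of those with depth at most $3$. For $G=\{\ell_1<\dots<\ell_g\}\in\mathcal{G}_{2n}(g)$ let $\alpha=\max\{i:\ell_{i+1}-\ell_i=2n\}$ and define $$\sigma(G)=\{1\}\cup\{\ell_i+1: 1\le i\le\alpha\}\cup\{\ell_i+2:\alpha+1\le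 i\le g\}$$ (note $\ell_1=1$, so $\sigma(G)=\{1<2<\ell_2+1<\dots<\ell_\alpha+1<\ell_{\alpha+1}+2<\dots<\ell_g+2\}$). -}

module Defs where

open import Data.Nat
open import Data.Nat.DivMod using (_/_)
open import Data.Nat.Properties
open import Data.Fin using (toℕ)
open import Data.List using (List; _∷_; _++_; length; map; zipWith; drop; take; findIndices)
open import Data.List.Extrema.Nat using (max; xs≤max; argmax-sel)
open import Data.List.Membership.Propositional using (_∈_; _∉_)
open import Data.List.Membership.DecPropositional _≟_ using (_∈?_)
open import Data.List.Relation.Unary.All as All using (All)
open import Data.List.Relation.Unary.Any using (Any)
open import Data.List.Relation.Unary.Linked using (Linked)
open import Data.Product using (∃; ∃-syntax; _×_; _,_; proj₁; proj₂)
open import Data.Sum using (_⊎_; inj₁; inj₂)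
open import Function using (_∘_; id)
open import Level using (0ℓ)
open import Relation.Binary.PropositionalEquality using (_≡_; refl; sym; subst)
open import Relation.Nullary using (yes; no; contradiction)
open import Relation.Nullary.Decidable using (_×-dec_; ¬?)
open import Relation.Unary using (Pred; Decidable; _∩_)

-- A finite subset {ℓ₁ < ⋯ < ℓ_g} of {1, 2, …} is represented by the list
-- ℓ₁ ∷ ⋯ ∷ ℓ_g ∷ [], so equality of sets is propositional equality of lists
-- and the genus is the length.

record IsGapset (G : List ℕ) : Set where
  field
    increasing : Linked _<_ G
    positive   : All (1 ≤_) G
    splits     : ∀ {x y} → 1 ≤ x → 1 ≤ y → x + y ∈ G → x ∈ G ⊎ y ∈ G

genus : List ℕ → ℕ
genus = length

IsLeast : Pred ℕ 0ℓ → Pred ℕ 0ℓ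
IsLeast P s = P s × (∀ {t} → P t → s ≤ t)

IsMultiplicity : List ℕ → Pred ℕ 0ℓ
IsMultiplicity G = IsLeast (λ s → 1 ≤ s × s ∉ G)

IsConductor : List ℕ → Pred ℕ 0ℓ
IsConductor G = IsLeast (λ s → 1 ≤ s × (∀ t → s + t ∉ G))

private
  least : {P : Pred ℕ 0ℓ} → Decidable P → ∃ P → ∃ (IsLeast P)
  least {P} P? (n , pn) with search (suc n)
    where
    search : ∀ k → ∃ (IsLeast P) ⊎ (∀ {t} → P t → k ≤ t)
    search zero = inj₂ λ _ → z≤n
    search (suc k) with search k
    ... | inj₁ found = inj₁ found
    ... | inj₂ k≤ with P? k
    ...   | yes pk = inj₁ (k , pk , k≤)
    ...   | no ¬pk = inj₂ λ pt → ≤∧≢⇒< (k≤ pt) λ { refl → ¬pk pt }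
  ... | inj₁ found = found
  ... | inj₂ n<    = contradiction (n< pn) (<-irrefl refl)

  max<⇒∉ : ∀ G {s} → max 0 G < s → s ∉ G
  max<⇒∉ G max<s s∈G = <⇒≱ max<s (All.lookup (xs≤max 0 G) s∈G)

hasMultiplicity : ∀ G → ∃ (IsMultiplicity G)
hasMultiplicity G =
  least (λ s → (1 ≤? s) ×-dec ¬? (s ∈? G))
        (suc (max 0 G) , s≤s z≤n , max<⇒∉ G ≤-refl)

hasConductor : ∀ G → ∃ (IsConductor G)
hasConductor G =
  suc (max 0 G) , (s≤s z≤n , λ t → max<⇒∉ G (s≤s (m≤m+n _ t))) , minimal
  where
  minimal : ∀ {s} → 1 ≤ s × (∀ t → s + t ∉ G) → suc (max 0 G) ≤ s
  minimal {s} (1≤s , s+t∉G) with suc (max 0 G) ≤? s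
  ... | yes max<s = max<s
  ... | no  max≮s with argmax-sel id 0 G
  ...   | inj₁ max≡0 = subst (λ k → suc k ≤ s) (sym max≡0) 1≤s
  ...   | inj₂ max∈G = contradiction
          (subst (_∈ G) (sym (m+[n∸m]≡n (≮⇒≥ max≮s))) max∈G)
          (s+t∉G (max 0 G ∸ s))

multiplicity : List ℕ → ℕ
multiplicity G = proj₁ (hasMultiplicity G)

conductor : List ℕ → ℕ
conductor G = proj₁ (hasConductor G)

-- The conductor is at least 1, so nothing is truncated.
frobenius : List ℕ → ℕ
frobenius G = conductor G ∸ 1

⌈_/_⌉ : (a b : ℕ) .{{_ : NonZero b}} → ℕ
⌈ a / b ⌉ = (a + (b ∸ 1)) / b

depth : List ℕ → ℕ
depth G = ⌈ conductor G / multiplicity G ⌉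
  where
  instance
    m≢0 : NonZero (multiplicity G)
    m≢0 = >-nonZero (proj₁ (proj₁ (proj₂ (hasMultiplicity G))))

-- F = 2g − 2, with the subtraction moved across to avoid truncation at g = 0.
PseudoSymmetric : Pred (List ℕ) 0ℓ
PseudoSymmetric G = IsGapset G × frobenius G + 2 ≡ 2 * genus G

-- The list ℓ₂ − ℓ₁, …, ℓ_g − ℓ_{g−1}; for increasing lists nothing is truncated.
differences : List ℕ → List ℕ
differences G = zipWith (λ x y → y ∸ x) G (drop 1 G)

PureSparse : ℕ → Pred (List ℕ) 0ℓ
PureSparse κ G = All (_≤ κ) (differences G) × Any (_≡ κ) (differences G)

𝒢 : (κ g : ℕ) → Pred (List ℕ) 0ℓ
𝒢 κ g G = IsGapset G × genus G ≡ g × PureSparse κ G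

𝒢[_,_,q≤3] : (κ g : ℕ) → Pred (List ℕ) 0ℓ
𝒢[ κ , g ,q≤3] = 𝒢 κ g ∩ (λ G → depth G ≤ 3)

𝒫 : (κ g : ℕ) → Pred (List ℕ) 0ℓ
𝒫 κ g = 𝒢 κ g ∩ PseudoSymmetric

-- The largest i, counted from 1, with ℓ_{i+1} − ℓ_i = κ.  The value 0 when
-- there is no such i is never used for pure κ-sparse G.
α : ℕ → List ℕ → ℕ
α κ G = max 0 (map (suc ∘ toℕ) (findIndices (_≟ κ) (differences G)))

σ : ℕ → List ℕ → List ℕ
σ n G = 1 ∷ map (_+ 1) (take a G) ++ map (_+ 2) (drop a G)
  where a = α (2 * n) G

Image : {A B : Set} → (A → B) → Pred A 0ℓ → Pred B 0ℓ
Image f P y = ∃[ x ] P x × f x ≡ y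

{-# OPTIONS --safe #-}

-- Let G have genus 3n + 1, depth at most 3 and last 2n-jump from a to
-- b = a + 2n.  Since b ∈ G but (a, b) misses G, the numbers 1, …, 2n − 1 lie in
-- G, so the multiplicity m is at least 2n.  Counting the pairs {i, z − i} shows
-- that z + 3 ≤ 2g as soon as z ∈ G is a sum of two distinct elements of G.
-- Splitting z as its predecessor plus their difference, this gives G < 6n, so
-- σ(G) avoids the pseudo-symmetric value 6n + 2; and a failure of the gapset
-- property in σ(G) would need an element of G that is too large.
-- Conversely, the same count shows that a pure (2n+1)-sparse gapset of genus
-- 3n + 2 that is not pseudo-symmetric is bounded by 6n + 1.  This makes its
-- (2n+1)-jump unique, leaves only differences below 2n after it, and undoing σ
-- there again gives a gapset.

module Submission where

open import Defs
import Algebra.Properties.CommutativeMonoid.Sum as Sum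
open import Data.Bool using (true; false; if_then_else_)
open import Data.Empty using (⊥; ⊥-elim)
open import Data.Fin using (Fin; zero; suc; toℕ; opposite)
open import Data.Fin.Permutation using (reverse)
open import Data.Fin.Properties using (opposite-prop; toℕ≤pred[n])
open import Data.List using (List; []; _∷_; _++_; [_]; length; map; take; drop; findIndices)
open import Data.List.Extrema.Nat using (max; xs≤max; argmax-sel; max≈v⁺; max<v⁺)
open import Data.List.Membership.Propositional using (_∈_; _∉_)
open import Data.List.Membership.Propositional.Properties
  using (∈-++⁺ˡ; ∈-++⁺ʳ; ∈-++⁻; ∈-map⁺; ∈-map⁻)
open import Data.List.Properties using (map-∘; map-++; length-map; ∷ʳ-++)
open import Data.List.Relation.Unary.All as All using (All; []; _∷_)
import Data.List.Relation.Unary.All.Properties as Allₚ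
open import Data.List.Relation.Unary.AllPairs as AllPairs using (AllPairs; []; _∷_)
open import Data.List.Relation.Unary.Any as Any using (Any; here; there)
import Data.List.Relation.Unary.Any.Properties as Anyₚ
open import Data.List.Relation.Unary.Linked as Linked using (Linked; []; [-]; _∷_)
open import Data.List.Relation.Unary.Linked.Properties using (Linked⇒AllPairs)
open import Data.Nat
open import Data.Nat.DivMod using (_/_; /-monoˡ-≤; m*n/n≡m; m<n*o⇒m/o<n)
open import Data.Nat.Properties
open import Data.Nat.Tactic.RingSolver using (solve)
open import Data.Product using (∃-syntax; _×_; _,_; proj₁; proj₂)
open import Data.Sum as ⊎ using (_⊎_; inj₁; inj₂; [_,_]′)
open import Function using (_∘_; id)
open import Level using (0ℓ)
open import Relation.Binary.PropositionalEquality
  using (_≡_; _≢_; refl; sym; trans; cong; cong₂; subst; module ≡-Reasoning)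
open import Relation.Nullary using (¬_; yes; no; does; contradiction)
open import Relation.Nullary.Decidable using (dec-true; dec-false)
open import Relation.Unary using (Pred; Empty; _∩_; _∖_; _≐_)
open import Data.List.Membership.DecPropositional _≟_ using (_∈?_)

-- The constructors of All and Linked are overloaded, and solve needs these unambiguous.
open List renaming (_∷_ to infixr 5 _∷ᵛ_; [] to []ᵛ)

open Sum +-0-commutativeMonoid
  using (sum; sum-syntax; ∑-distrib-+; sum-permute; sum-replicate-zero)

-- Linear arithmetic by certificate: l ≤ r is a sum of hypotheses, and the
-- equation, discharged by the ring solver, says that it implies s ≤ t.
linear : ∀ {l r s t} c → l ≤ r → s + r + c ≡ t + l → s ≤ t
linear {l} {r} {s} {t} c l≤r eq = +-cancelʳ-≤ l s t (begin
  s + l      ≤⟨ +-monoʳ-≤ s l≤r ⟩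
  s + r      ≤⟨ m≤m+n (s + r) c ⟩
  s + r + c  ≡⟨ eq ⟩
  t + l      ∎)
  where open ≤-Reasoning

infixr 5 _⊕_
_⊕_ : ∀ {a b c d} → a ≤ b → c ≤ d → a + c ≤ b + d
_⊕_ = +-mono-≤

1≰0 : ¬ 1 ≤ 0
1≰0 ()

-- Counting

-- The Kronecker delta, by recursion on both arguments so that sums of it over `Fin` unfold
-- definitionally.
δ : ℕ → ℕ → ℕ
δ zero    zero    = 1
δ zero    (suc _) = 0
δ (suc _) zero    = 0
δ (suc x) (suc i) = δ x i

δ-refl : ∀ x → δ x x ≡ 1
δ-refl zero    = refl
δ-refl (suc x) = δ-refl x

δ-≢ : ∀ {x i} → x ≢ i → δ x i ≡ 0
δ-≢ {zero}  {zero}  x≢i = contradiction refl x≢i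
δ-≢ {zero}  {suc _} _   = refl
δ-≢ {suc _} {zero}  _   = refl
δ-≢ {suc x} {suc i} x≢i = δ-≢ {x} {i} (x≢i ∘ cong suc)

∑-δ≤1 : ∀ k x → ∑[ i < k ] δ x (toℕ i) ≤ 1
∑-δ≤1 zero    x       = z≤n
∑-δ≤1 (suc k) zero    = s≤s (≤-reflexive (sum-replicate-zero k))
∑-δ≤1 (suc k) (suc x) = ∑-δ≤1 k x

1≤∑-δ : ∀ {k x} → x < k → 1 ≤ ∑[ i < k ] δ x (toℕ i)
1≤∑-δ {suc k} {zero}  _         = s≤s z≤n
1≤∑-δ {suc k} {suc x} (s≤s x<k) = 1≤∑-δ x<k

∑-mono-≤ : ∀ {k} {f g : Fin k → ℕ} → (∀ i → f i ≤ g i) → sum f ≤ sum g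
∑-mono-≤ {zero}  f≤g = z≤n
∑-mono-≤ {suc k} f≤g = f≤g zero ⊕ ∑-mono-≤ (f≤g ∘ suc)

∑-const-1 : ∀ k → ∑[ i < k ] 1 ≡ k
∑-const-1 zero    = refl
∑-const-1 (suc k) = cong suc (∑-const-1 k)

-- Counting with multiplicity makes the sum over any range at most `length G`, by induction on the
-- list.
count : List ℕ → ℕ → ℕ
count []      i = 0
count (x ∷ G) i = δ x i + count G i

∈⇒1≤count : ∀ {G x} → x ∈ G → 1 ≤ count G x
∈⇒1≤count {x = x} (here refl) rewrite δ-refl x = s≤s z≤n
∈⇒1≤count {G = y ∷ G} {x} (there x∈) = ≤-trans (∈⇒1≤count x∈) (m≤n+m _ (δ y x))

∑-count≤length : ∀ k G → ∑[ i < k ] count G (toℕ i) ≤ length G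
∑-count≤length k []      = ≤-reflexive (sum-replicate-zero k)
∑-count≤length k (x ∷ G) = begin
  ∑[ i < k ] (δ x (toℕ i) + count G (toℕ i))
    ≡⟨ ∑-distrib-+ {k} (λ i → δ x (toℕ i)) (λ i → count G (toℕ i)) ⟩
  ∑[ i < k ] δ x (toℕ i) + ∑[ i < k ] count G (toℕ i)
    ≤⟨ ∑-δ≤1 k x ⊕ ∑-count≤length k G ⟩
  suc (length G) ∎
  where open ≤-Reasoning

-- Summing over the pairs {i, z − i}.
pairs-bound : ∀ G {z} (e : ℕ → ℕ) →
              (∀ x y → x + y ≡ z → 1 + e x ≤ count G x + count G y) →
              suc z + ∑[ i < suc z ] e (toℕ i) ≤ 2 * length G
pairs-bound G {z} e bound = begin
  suc z + ∑e
    ≡⟨ cong (_+ ∑e) (sym (∑-const-1 (suc z))) ⟩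
  ∑[ i < suc z ] 1 + ∑e
    ≡⟨ ∑-distrib-+ {suc z} (λ _ → 1) (λ i → e (toℕ i)) ⟨
  ∑[ i < suc z ] (1 + e (toℕ i))
    ≤⟨ ∑-mono-≤ {suc z} (λ i → bound (toℕ i) (toℕ (opposite i)) (sum-opposite i)) ⟩
  ∑[ i < suc z ] (c i + c (opposite i))
    ≡⟨ ∑-distrib-+ {suc z} c (c ∘ opposite) ⟩
  sum c + sum (c ∘ opposite)
    -- The map i ↦ z - i permutes 0, ..., z, so both sums agree.
    ≡⟨ cong (sum c +_) (sum-permute c reverse) ⟨
  sum c + sum c
    ≤⟨ ∑-count≤length (suc z) G ⊕ ∑-count≤length (suc z) G ⟩
  length G + length G
    ≡⟨ cong (length G +_) (sym (+-identityʳ _)) ⟩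
  2 * length G ∎
  where
  open ≤-Reasoning
  ∑e = ∑[ i < suc z ] e (toℕ i)
  c : Fin (suc z) → ℕ
  c i = count G (toℕ i)
  sum-opposite : ∀ i → toℕ i + toℕ (opposite i) ≡ z
  sum-opposite i = trans (cong (toℕ i +_) (opposite-prop i)) (m+[n∸m]≡n (toℕ≤pred[n] i))

-- A zero summand leaves z itself as the other one; hence i may run over all of 0, ..., z in the
-- count.
gapset-covers : ∀ {G x y z} → IsGapset G → z ∈ G → x + y ≡ z → x ∈ G ⊎ y ∈ G
gapset-covers {x = zero} _ z∈ refl = inj₂ z∈
gapset-covers {G} {suc x} {zero} _ z∈ refl = inj₁ (subst (_∈ G) (+-identityʳ (suc x)) z∈)
gapset-covers {x = suc x} {suc y} gap z∈ refl = IsGapset.splits gap (s≤s z≤n) (s≤s z≤n) z∈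

covered⇒1≤count : ∀ G x y → x ∈ G ⊎ y ∈ G → 1 ≤ count G x + count G y
covered⇒1≤count _ _ _ (inj₁ x∈) = ≤-trans (∈⇒1≤count x∈) (m≤m+n _ _)
covered⇒1≤count _ _ _ (inj₂ y∈) = ≤-trans (∈⇒1≤count y∈) (m≤n+m _ _)

-- The classical bound F ≤ 2g - 1: the count with no excess.
gapset-bound : ∀ {G z} → IsGapset G → z ∈ G → suc z ≤ 2 * length G
gapset-bound {G} {z} gap z∈ = ≤-trans (m≤m+n (suc z) _)
  (pairs-bound G (λ _ → 0) λ x y eq → covered⇒1≤count G x y (gapset-covers gap z∈ eq))

-- Each index i ≤ z contributes at least 1. The indices x and y contribute one more each, as both
-- members of their pair lie in G; being distinct, they give a total excess of 2.
pair-bound : ∀ {G x y z} → IsGapset G → x ∈ G → y ∈ G → x ≢ y → z ∈ G → x + y ≡ z →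
             z + 3 ≤ 2 * length G
pair-bound {G} {x} {y} {z} gap x∈ y∈ x≢y z∈ eq = begin
  z + 3            ≡⟨ +-suc z 2 ⟩
  suc z + 2        ≤⟨ +-monoʳ-≤ (suc z) (1≤∑-δ (s≤s x≤z) ⊕ 1≤∑-δ (s≤s y≤z)) ⟩
  suc z + (∑[ i < suc z ] δ x (toℕ i) + ∑[ i < suc z ] δ y (toℕ i))
                   ≡⟨ cong (suc z +_) (∑-distrib-+ {suc z} (λ i → δ x (toℕ i)) (λ i → δ y (toℕ i))) ⟨
  suc z + ∑[ i < suc z ] e (toℕ i)
                   ≤⟨ pairs-bound G e pointwise ⟩
  2 * length G     ∎
  where
  open ≤-Reasoning
  e : ℕ → ℕ
  e i = δ x i + δ y i
  x≤z : x ≤ z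
  x≤z = subst (x ≤_) eq (m≤m+n x y)
  y≤z : y ≤ z
  y≤z = subst (y ≤_) eq (m≤n+m y x)
  pointwise : ∀ u v → u + v ≡ z → 1 + e u ≤ count G u + count G v
  pointwise u v uv with x ≟ u | y ≟ u
  ... | yes refl | yes refl = contradiction refl x≢y
  ... | yes refl | no  y≢x
    rewrite δ-refl x | δ-≢ y≢x | +-cancelˡ-≡ x v y (trans uv (sym eq)) =
    ∈⇒1≤count x∈ ⊕ ∈⇒1≤count y∈
  ... | no  x≢y  | yes refl
    rewrite δ-refl y | δ-≢ x≢y | +-cancelˡ-≡ y v x (trans uv (trans (sym eq) (+-comm x y))) =
    ∈⇒1≤count y∈ ⊕ ∈⇒1≤count x∈
  ... | no  x≢u  | no  y≢u
    rewrite δ-≢ x≢u | δ-≢ y≢u = covered⇒1≤count G u v (gapset-covers gap z∈ uv)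

-- Differences and jumps

linked⇒positive : ∀ {G} → Linked _<_ G → All (1 ≤_) (differences G)
linked⇒positive []        = []
linked⇒positive [-]       = []
linked⇒positive (x<y ∷ l) = m<n⇒0<n∸m x<y ∷ linked⇒positive l

positive⇒linked : ∀ G → All (1 ≤_) (differences G) → Linked _<_ G
positive⇒linked []          _        = []
positive⇒linked (_ ∷ [])    _        = [-]
positive⇒linked (x ∷ y ∷ G) (p ∷ ps) =
  m∸n≢0⇒n<m (λ eq → 1≰0 (subst (1 ≤_) eq p)) ∷ positive⇒linked (y ∷ G) ps

differences-++ : ∀ xs a b ys →
  differences (xs ++ a ∷ b ∷ ys) ≡ differences (xs ++ [ a ]) ++ (b ∸ a) ∷ differences (b ∷ ys)
differences-++ []            a b ys = refl
differences-++ (x ∷ [])      a b ys = refl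
differences-++ (x ∷ x′ ∷ xs) a b ys = cong ((x′ ∸ x) ∷_) (differences-++ (x′ ∷ xs) a b ys)

+k-∸-+k : ∀ k x y → (y + k) ∸ (x + k) ≡ y ∸ x
+k-∸-+k k x y rewrite +-comm y k | +-comm x k = [m+n]∸[m+o]≡n∸o k y x

differences-map-+ : ∀ k xs → differences (map (_+ k) xs) ≡ differences xs
differences-map-+ k []           = refl
differences-map-+ k (x ∷ [])     = refl
differences-map-+ k (x ∷ y ∷ xs) = cong₂ _∷_ (+k-∸-+k k x y) (differences-map-+ k (y ∷ xs))

length-differences : ∀ xs a → length (differences (xs ++ [ a ])) ≡ length xs
length-differences []            a = refl
length-differences (x ∷ [])      a = refl
length-differences (x ∷ x′ ∷ xs) a = cong suc (length-differences (x′ ∷ xs) a)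

All-differences : ∀ {P : Pred ℕ 0ℓ} G → Linked _<_ G →
  (∀ {x y} → x ∈ G → y ∈ G → x < y → P (y ∸ x)) → All P (differences G)
All-differences []          _         _ = []
All-differences (_ ∷ [])    _         _ = []
All-differences (x ∷ y ∷ G) (x<y ∷ l) P =
  P (here refl) (there (here refl)) x<y ∷
  All-differences (y ∷ G) l (λ u∈ v∈ → P (there u∈) (there v∈))

-- Turns a property of the differences into a decomposition z = p + d, the form that `pair-bound`
-- and the splitting arguments use.
predecessor : ∀ {P : Pred ℕ 0ℓ} {x xs z} → Linked _<_ (x ∷ xs) → All P (differences (x ∷ xs)) →
  z ∈ xs → ∃[ p ] ∃[ d ] p ∈ x ∷ xs × 1 ≤ d × P d × p + d ≡ z
predecessor {x = x} {z = z} (x<y ∷ _) (p ∷ _) (here refl) =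
  x , z ∸ x , here refl , m<n⇒0<n∸m x<y , p , m+[n∸m]≡n (<⇒≤ x<y)
predecessor {xs = _ ∷ _} (_ ∷ l) (_ ∷ ps) (there z∈) with predecessor l ps z∈
... | p , d , p∈ , rest = p , d , there p∈ , rest

-- Used to undo σ: below the first jump of a κ-sparse set all differences are smaller than κ.
FirstJump : ℕ → List ℕ → Set
FirstJump κ G = ∃[ xs ] ∃[ a ] ∃[ b ] ∃[ ys ] G ≡ xs ++ a ∷ b ∷ ys × b ∸ a ≡ κ ×
  All (_≢ κ) (differences (xs ++ [ a ]))

firstJump : ∀ κ G → Any (_≡ κ) (differences G) → FirstJump κ G
firstJump κ (x ∷ y ∷ G) any with (y ∸ x) ≟ κ | any
... | yes eq | _         = [] , x , y , G , refl , eq , []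
... | no neq | here eq   = contradiction eq neq
... | no neq | there any′ with firstJump κ (y ∷ G) any′
-- Splitting on the prefix exposes y as the next entry, so that the new difference y - x computes.
...   | [] , a , b , ys , refl , eq , _ = [ x ] , a , b , ys , refl , eq , neq ∷ []
...   | _ ∷ xs , a , b , ys , refl , eq , ≢κ = x ∷ y ∷ xs , a , b , ys , refl , eq , neq ∷ ≢κ

-- The cut that `α` makes.
LastJump : ℕ → List ℕ → Set
LastJump κ G = ∃[ xs ] ∃[ a ] ∃[ b ] ∃[ ys ] G ≡ xs ++ a ∷ b ∷ ys × b ∸ a ≡ κ ×
  All (_≢ κ) (differences (b ∷ ys))

lastJump : ∀ κ G → Any (_≡ κ) (differences G) → LastJump κ G
lastJump κ (x ∷ y ∷ G) any
  with Any.any? (_≟ κ) (differences (y ∷ G)) | any | lastJump κ (y ∷ G)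
... | no ¬any  | here eq    | _ = [] , x , y , G , refl , eq , Allₚ.¬Any⇒All¬ _ ¬any
... | no ¬any  | there any′ | _ = contradiction any′ ¬any
... | yes any′ | _          | rec with rec any′
...   | xs , a , b , ys , G≡ , rest = x ∷ xs , a , b , ys , cong (x ∷_) G≡ , rest

-- The shift σ

indices : ℕ → List ℕ → List ℕ
indices κ ds = map (suc ∘ toℕ) (findIndices (_≟ κ) ds)

-- `findIndices` moves the positions in the tail up by `Fin.suc`, which `suc ∘ toℕ` turns into `suc`
-- on numbers.
indices-∷ : ∀ κ d ds →
  indices κ (d ∷ ds) ≡ (if does (d ≟ κ) then [ 1 ] else []) ++ map suc (indices κ ds)
indices-∷ κ d ds with does (d ≟ κ)
... | true  = cong (1 ∷_) (trans (sym (map-∘ (findIndices (_≟ κ) ds))) (map-∘ (findIndices (_≟ κ) ds)))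
... | false = trans (sym (map-∘ (findIndices (_≟ κ) ds))) (map-∘ (findIndices (_≟ κ) ds))

indices-none : ∀ {κ ds} → All (_≢ κ) ds → indices κ ds ≡ []
indices-none [] = refl
indices-none {κ} {d ∷ ds} (d≢κ ∷ ≢κ)
  rewrite indices-∷ κ d ds | indices-none ≢κ | dec-false (d ≟ κ) d≢κ = refl

last∈indices : ∀ {κ} ds₁ {ds₂} → suc (length ds₁) ∈ indices κ (ds₁ ++ κ ∷ ds₂)
last∈indices {κ} [] {ds₂} rewrite dec-true (κ ≟ κ) refl = here refl
last∈indices {κ} (d ∷ ds₁) {ds₂} rewrite indices-∷ κ d (ds₁ ++ κ ∷ ds₂) =
  ∈-++⁺ʳ _ (∈-map⁺ suc (last∈indices ds₁))

indices≤last : ∀ {κ} ds₁ {ds₂} → All (_≢ κ) ds₂ →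
  All (_≤ suc (length ds₁)) (indices κ (ds₁ ++ κ ∷ ds₂))
indices≤last {κ} [] {ds₂} ≢κ
  rewrite indices-∷ κ κ ds₂ | indices-none ≢κ | dec-true (κ ≟ κ) refl = ≤-refl ∷ []
indices≤last {κ} (d ∷ ds₁) {ds₂} ≢κ rewrite indices-∷ κ d (ds₁ ++ κ ∷ ds₂) =
  Allₚ.++⁺ (1∷ (does (d ≟ κ))) (Allₚ.map⁺ (All.map s≤s (indices≤last ds₁ ≢κ)))
  where
  1∷ : ∀ b → All (_≤ suc (suc (length ds₁))) (if b then [ 1 ] else [])
  1∷ true  = s≤s z≤n ∷ []
  1∷ false = []

-- There are as many differences before the jump as entries in `xs`, so counted from 1 the jump has
-- position 1 + |xs|; no later difference equals κ.
α-lastJump : ∀ {κ} xs a b ys → b ∸ a ≡ κ → All (_≢ κ) (differences (b ∷ ys)) →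
  α κ (xs ++ a ∷ b ∷ ys) ≡ suc (length xs)
α-lastJump xs a b ys refl ≢κ
  rewrite differences-++ xs a b ys | sym (length-differences xs a) =
  max≈v⁺ (last∈indices ds₁) (indices≤last ds₁ ≢κ) z≤n
  where ds₁ = differences (xs ++ [ a ])

-- σ with an explicit cut instead of `α`, so that it can be undone before the cut is known to be the
-- last jump.
shift : List ℕ → ℕ → ℕ → List ℕ → List ℕ
shift xs a b ys = 1 ∷ map (_+ 1) (xs ++ [ a ]) ++ map (_+ 2) (b ∷ ys)

σ-lastJump : ∀ n xs a b ys → b ∸ a ≡ 2 * n → All (_≢ 2 * n) (differences (b ∷ ys)) →
  σ n (xs ++ a ∷ b ∷ ys) ≡ shift xs a b ys
σ-lastJump n xs a b ys eq ≢κ rewrite α-lastJump xs a b ys eq ≢κ =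
  cong (1 ∷_) (cong₂ _++_ (cong (map (_+ 1)) (take-xs xs)) (cong (map (_+ 2)) (drop-xs xs)))
  where
  take-xs : ∀ xs → take (suc (length xs)) (xs ++ a ∷ b ∷ ys) ≡ xs ++ [ a ]
  take-xs []       = refl
  take-xs (x ∷ xs) = cong (x ∷_) (take-xs xs)
  drop-xs : ∀ xs → drop (suc (length xs)) (xs ++ a ∷ b ∷ ys) ≡ b ∷ ys
  drop-xs []       = refl
  drop-xs (x ∷ xs) = drop-xs xs

shift-++ : ∀ xs a b ys →
  shift xs a b ys ≡ (1 ∷ map (_+ 1) xs) ++ (a + 1) ∷ (b + 2) ∷ map (_+ 2) ys
shift-++ xs a b ys rewrite map-++ (_+ 1) xs [ a ] =
  cong (1 ∷_) (∷ʳ-++ (map (_+ 1) xs) (a + 1) (map (_+ 2) (b ∷ ys)))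

first : List ℕ → ℕ → ℕ
first []      a = a
first (x ∷ _) a = x

-- The prepended 1 contributes (ℓ₁ + 1) - 1 = ℓ₁; the translation by 1 keeps the rest.
differences-lower : ∀ xs a →
  differences ((1 ∷ map (_+ 1) xs) ++ [ a + 1 ]) ≡ first xs a ∷ differences (xs ++ [ a ])
differences-lower xs a = trans (cong (λ l → differences (1 ∷ l)) (sym (map-++ (_+ 1) xs [ a ]))) (lower xs)
  where
  lower : ∀ xs → differences (1 ∷ map (_+ 1) (xs ++ [ a ])) ≡ first xs a ∷ differences (xs ++ [ a ])
  lower []       = cong (_∷ []) (m+n∸n≡m a 1)
  lower (x ∷ xs) = cong₂ _∷_ (m+n∸n≡m x 1) (differences-map-+ 1 (x ∷ xs ++ [ a ]))

-- Each side of the cut is translated as a whole, so only the jump across the cut changes, besides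
-- the new leading difference.
differences-shift : ∀ xs a b ys → differences (shift xs a b ys) ≡
  (first xs a ∷ differences (xs ++ [ a ])) ++ ((b + 2) ∸ (a + 1)) ∷ differences (b ∷ ys)
differences-shift xs a b ys = begin
  differences (shift xs a b ys)
    ≡⟨ cong differences (shift-++ xs a b ys) ⟩
  differences ((1 ∷ map (_+ 1) xs) ++ (a + 1) ∷ (b + 2) ∷ map (_+ 2) ys)
    ≡⟨ differences-++ (1 ∷ map (_+ 1) xs) (a + 1) (b + 2) (map (_+ 2) ys) ⟩
  differences ((1 ∷ map (_+ 1) xs) ++ [ a + 1 ]) ++ d ∷ differences (map (_+ 2) (b ∷ ys))
    ≡⟨ cong₂ (λ l u → l ++ d ∷ u) (differences-lower xs a) (differences-map-+ 2 (b ∷ ys)) ⟩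
  (first xs a ∷ differences (xs ++ [ a ])) ++ d ∷ differences (b ∷ ys) ∎
  where
  open ≡-Reasoning
  d = (b + 2) ∸ (a + 1)

length-shift : ∀ xs a b ys → length (shift xs a b ys) ≡ suc (length (xs ++ a ∷ b ∷ ys))
length-shift xs a b ys = cong suc (tail xs)
  where
  tail : ∀ xs → length (map (_+ 1) (xs ++ [ a ]) ++ map (_+ 2) (b ∷ ys)) ≡ length (xs ++ a ∷ b ∷ ys)
  tail []       = cong (2 +_) (length-map (_+ 2) ys)
  tail (_ ∷ xs) = cong suc (tail xs)

-- Indexed by the value, so that matching on the origin of an element also puts it in the form 1, z
-- + 1 or z + 2.
data ∈Shift (lo hi : List ℕ) : ℕ → Set where
  one   : ∈Shift lo hi 1
  below : ∀ {z} → z ∈ lo → ∈Shift lo hi (z + 1)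
  above : ∀ {z} → z ∈ hi → ∈Shift lo hi (z + 2)

∈shift⁻ : ∀ {xs a b ys z} → z ∈ shift xs a b ys → ∈Shift (xs ++ [ a ]) (b ∷ ys) z
∈shift⁻ (here refl) = one
∈shift⁻ {xs} {a} (there z∈) with ∈-++⁻ (map (_+ 1) (xs ++ [ a ])) z∈
... | inj₁ z∈lo with ∈-map⁻ (_+ 1) z∈lo
...   | _ , x∈ , refl = below x∈
∈shift⁻ (there z∈) | inj₂ z∈hi with ∈-map⁻ (_+ 2) z∈hi
...   | _ , x∈ , refl = above x∈

∈shift⁺ : ∀ {xs a b ys z} → ∈Shift (xs ++ [ a ]) (b ∷ ys) z → z ∈ shift xs a b ys
∈shift⁺ one = here refl
∈shift⁺ (below z∈) = there (∈-++⁺ˡ (∈-map⁺ (_+ 1) z∈))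
∈shift⁺ {xs} {a} (above z∈) = there (∈-++⁺ʳ (map (_+ 1) (xs ++ [ a ])) (∈-map⁺ (_+ 2) z∈))

-- Increasing lists cut at a jump

module Jump {xs a b ys} (increasing : Linked _<_ (xs ++ a ∷ b ∷ ys)) where

  G lo hi : List ℕ
  G  = xs ++ a ∷ b ∷ ys
  lo = xs ++ [ a ]
  hi = b ∷ ys

  G≡lo++hi : G ≡ lo ++ hi
  G≡lo++hi = sym (∷ʳ-++ xs a hi)

  lo⊆G : ∀ {x} → x ∈ lo → x ∈ G
  lo⊆G x∈ = subst (_ ∈_) (sym G≡lo++hi) (∈-++⁺ˡ x∈)

  hi⊆G : ∀ {x} → x ∈ hi → x ∈ G
  hi⊆G x∈ = subst (_ ∈_) (sym G≡lo++hi) (∈-++⁺ʳ lo x∈)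

  lo⊎hi : ∀ {x} → x ∈ G → x ∈ lo ⊎ x ∈ hi
  lo⊎hi x∈ = ∈-++⁻ lo (subst (_ ∈_) G≡lo++hi x∈)

  a∈lo : a ∈ lo
  a∈lo = ∈-++⁺ʳ xs (here refl)

  private
    ≤a′ : ∀ xs → AllPairs _<_ (xs ++ a ∷ b ∷ ys) → ∀ {x} → x ∈ xs ++ [ a ] → x ≤ a
    ≤a′ []       _        (here refl) = ≤-refl
    ≤a′ (_ ∷ xs) (x< ∷ _) (here refl) = <⇒≤ (All.lookup x< (∈-++⁺ʳ xs (here refl)))
    ≤a′ (_ ∷ xs) (_ ∷ l)  (there x∈)  = ≤a′ xs l x∈

    tail-linked : ∀ xs → Linked _<_ (xs ++ a ∷ b ∷ ys) → Linked _<_ (a ∷ b ∷ ys)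
    tail-linked []       l = l
    tail-linked (_ ∷ xs) l = tail-linked xs (Linked.tail l)

  ≤a : ∀ {x} → x ∈ lo → x ≤ a
  ≤a = ≤a′ xs (Linked⇒AllPairs <-trans increasing)

  hi-increasing : Linked _<_ hi
  hi-increasing = Linked.tail (tail-linked xs increasing)

  a<b : a < b
  a<b = Linked.head (tail-linked xs increasing)

  b≤ : ∀ {x} → x ∈ hi → b ≤ x
  b≤ (here refl) = ≤-refl
  b≤ (there x∈)  = <⇒≤ (All.lookup (AllPairs.head (Linked⇒AllPairs <-trans hi-increasing)) x∈)

  <b⇒∈lo : ∀ {x} → x ∈ G → x < b → x ∈ lo
  <b⇒∈lo x∈ x<b with lo⊎hi x∈
  ... | inj₁ x∈lo = x∈lo
  ... | inj₂ x∈hi = contradiction (b≤ x∈hi) (<⇒≱ x<b)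

  jump : ∀ {x} → a < x → x < b → x ∉ G
  jump a<x x<b x∈ = <⇒≱ a<x (≤a (<b⇒∈lo x∈ x<b))

-- Consequences of the gapset property

All-jump⁻ : ∀ {P : Pred ℕ 0ℓ} xs a b ys → All P (differences (xs ++ a ∷ b ∷ ys)) →
  All P (differences (xs ++ [ a ])) × P (b ∸ a) × All P (differences (b ∷ ys))
All-jump⁻ xs a b ys ps
  with Allₚ.++⁻ (differences (xs ++ [ a ])) (subst (All _) (differences-++ xs a b ys) ps)
... | ps₁ , p ∷ ps₂ = ps₁ , p , ps₂

All-jump⁺ : ∀ {P : Pred ℕ 0ℓ} xs a b ys → All P (differences (xs ++ [ a ])) → P (b ∸ a) →
  All P (differences (b ∷ ys)) → All P (differences (xs ++ a ∷ b ∷ ys))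
All-jump⁺ xs a b ys ps₁ p ps₂ = subst (All _) (sym (differences-++ xs a b ys)) (Allₚ.++⁺ ps₁ (p ∷ ps₂))

-- A least element y ≥ 2 would split as 1 + (y - 1), putting a smaller element into G.
gapset-∷ : ∀ {G z} → IsGapset G → z ∈ G → ∃[ xs ] G ≡ 1 ∷ xs
gapset-∷ {zero ∷ _} gap _ = ⊥-elim (1≰0 (All.head (IsGapset.positive gap)))
gapset-∷ {suc zero ∷ xs} gap _ = xs , refl
gapset-∷ {suc (suc x) ∷ xs} gap _ =
  [ (λ ∈G → contradiction (least ∈G) λ { (s≤s ()) })
  , (λ ∈G → contradiction (least ∈G) 1+n≰n)
  ]′ (IsGapset.splits gap {1} {suc x} (s≤s z≤n) (s≤s z≤n) (here refl))
  where
  least : ∀ {y} → y ∈ suc (suc x) ∷ xs → suc (suc x) ≤ y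
  least (here refl) = ≤-refl
  least (there y∈)  =
    <⇒≤ (All.lookup (AllPairs.head (Linked⇒AllPairs <-trans (IsGapset.increasing gap))) y∈)

gapset-predecessor : ∀ {P : Pred ℕ 0ℓ} {G z} → IsGapset G → All P (differences G) →
  z ∈ G → 1 < z → ∃[ p ] ∃[ d ] p ∈ G × 1 ≤ d × P d × p + d ≡ z
gapset-predecessor gap ps z∈ 1<z with gapset-∷ gap z∈
gapset-predecessor gap ps (here refl) 1<z | xs , refl = contradiction 1<z (<-irrefl refl)
gapset-predecessor gap ps (there z∈)  1<z | xs , refl = predecessor (IsGapset.increasing gap) ps z∈

first-∷ : ∀ xs {a x zs ys} → xs ++ a ∷ ys ≡ x ∷ zs → first xs a ≡ x
first-∷ []      refl = refl
first-∷ (_ ∷ _) refl = refl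

-- In a + k = i + (a + k - i) the second summand lies inside the jump, so the first must be in G.
jump⇒initial : ∀ {G a k i} → IsGapset G → (∀ {x} → a < x → x < a + k → x ∉ G) → a + k ∈ G →
  1 ≤ i → i < k → i ∈ G
jump⇒initial {G} {a} {i = i} gap jump b∈ 1≤i i<k with m≤n⇒∃[o]m+o≡n i<k
... | o , refl = [ id , (λ j∈ → contradiction j∈ (jump a< <b)) ]′ (gapset-covers gap b∈ eq)
  where
  eq : i + (a + suc o) ≡ a + (suc i + o)
  eq = solve (a ∷ᵛ i ∷ᵛ o ∷ᵛ []ᵛ)
  a< : a < a + suc o
  a< = m<m+n a (s≤s z≤n)
  <b : a + suc o < a + (suc i + o)
  <b = linear 0 1≤i (solve (a ∷ᵛ i ∷ᵛ o ∷ᵛ []ᵛ))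

-- Decidable membership allows `splits` to be proved by refuting two uncovered summands.
∈⊎∈ : ∀ {G x y} → (x ∉ G → y ∉ G → ⊥) → x ∈ G ⊎ y ∈ G
∈⊎∈ {G} {x} {y} absurd with x ∈? G | y ∈? G
... | yes x∈ | _      = inj₁ x∈
... | no _   | yes y∈ = inj₂ y∈
... | no x∉  | no y∉  = ⊥-elim (absurd x∉ y∉)

initial⊆G : ∀ {G m i} → IsMultiplicity G m → 1 ≤ i → i < m → i ∈ G
initial⊆G {G} {i = i} (_ , least) 1≤i i<m with i ∈? G
... | yes i∈ = i∈
... | no  i∉ = contradiction (least (1≤i , i∉)) (<⇒≱ i<m)

⌈/⌉≤3⇒≤3* : ∀ c m .{{_ : NonZero m}} → ⌈ c / m ⌉ ≤ 3 → c ≤ 3 * m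
⌈/⌉≤3⇒≤3* c m@(suc k) q≤3 = ≮⇒≥ λ 3m<c → <⇒≱ (s≤s q≤3) (begin
  4            ≡⟨ m*n/n≡m 4 m ⟨
  4 * m / m    ≤⟨ /-monoˡ-≤ m (4m≤c+k 3m<c) ⟩
  (c + k) / m  ∎)
  where
  open ≤-Reasoning
  4m≤c+k : 3 * suc k < c → 4 * suc k ≤ c + k
  4m≤c+k 3m<c = linear 0 3m<c (solve (k ∷ᵛ c ∷ᵛ []ᵛ))

≤3*⇒⌈/⌉≤3 : ∀ c m .{{_ : NonZero m}} → c ≤ 3 * m → ⌈ c / m ⌉ ≤ 3
≤3*⇒⌈/⌉≤3 c m@(suc k) c≤3m = s≤s⁻¹ (m<n*o⇒m/o<n c+k<4m)
  where
  c+k<4m : c + k < 4 * suc k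
  c+k<4m = linear 0 c≤3m (solve (k ∷ᵛ c ∷ᵛ []ᵛ))

depth≤3⇒<3* : ∀ {G z} → depth G ≤ 3 → z ∈ G → z < 3 * multiplicity G
-- `conductor G` computes to 1 + max 0 G.
depth≤3⇒<3* {G} q≤3 z∈ = ≤-trans (s≤s (All.lookup (xs≤max 0 G) z∈))
  (⌈/⌉≤3⇒≤3* (conductor G) (multiplicity G)
    {{>-nonZero (proj₁ (proj₁ (proj₂ (hasMultiplicity G))))}} q≤3)

conductor≤3*⇒depth≤3 : ∀ {G} → conductor G ≤ 3 * multiplicity G → depth G ≤ 3
conductor≤3*⇒depth≤3 {G} = ≤3*⇒⌈/⌉≤3 (conductor G) (multiplicity G)
    {{>-nonZero (proj₁ (proj₁ (proj₂ (hasMultiplicity G))))}}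

max≡suc⇒∈ : ∀ {k} G → max 0 G ≡ suc k → suc k ∈ G
max≡suc⇒∈ G eq with argmax-sel id 0 G
... | inj₁ max≡0 = contradiction (trans (sym eq) max≡0) λ ()
... | inj₂ max∈  = subst (_∈ G) eq max∈

shift-jump : ∀ a {b k} → b ≡ a + k → (b + 2) ∸ (a + 1) ≡ k + 1
shift-jump a {k = k} refl = trans (cong (_∸ (a + 1)) eq) (m+n∸n≡m (k + 1) (a + 1))
  where
  eq : a + k + 2 ≡ (k + 1) + (a + 1)
  eq = solve (a ∷ᵛ k ∷ᵛ []ᵛ)

-- From G to σ(G)

module Forward
  (n : ℕ) (1≤n : 1 ≤ n) (xs : List ℕ) (a b : ℕ) (ys : List ℕ)
  (gap : IsGapset (xs ++ a ∷ b ∷ ys)) (length-G : length (xs ++ a ∷ b ∷ ys) ≡ 3 * n + 1)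
  (b≡ : b ≡ a + 2 * n)
  (≤2n : All (_≤ 2 * n) (differences (xs ++ a ∷ b ∷ ys))) (≢2n : All (_≢ 2 * n) (differences (b ∷ ys)))
  (q≤3 : depth (xs ++ a ∷ b ∷ ys) ≤ 3)
  where

  open Jump {xs} {a} {b} {ys} (IsGapset.increasing gap)

  σG : List ℕ
  σG = shift xs a b ys

  m : ℕ
  m = multiplicity G

  isMultiplicity : IsMultiplicity G m
  isMultiplicity = proj₂ (hasMultiplicity G)

  1≤m : 1 ≤ m
  1≤m = proj₁ (proj₁ isMultiplicity)

  m∉G : m ∉ G
  m∉G = proj₂ (proj₁ isMultiplicity)

  a+2n≤b : a + 2 * n ≤ b
  a+2n≤b = ≤-reflexive (sym b≡)

  private
    -- Below, multiplicity G is replaced by a variable that solve can treat as an atom.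
    module _ (m : ℕ) where
      3m-bound : ∀ {z} → z < 3 * m → 6 * n ≤ z → 2 * n < m
      3m-bound {z} z<3m 6n≤z = ≰⇒> λ (m≤2n : m ≤ 2 * n) →
        1≰0 (linear 0 (z<3m ⊕ 6n≤z ⊕ m≤2n ⊕ m≤2n ⊕ m≤2n) (solve (z ∷ᵛ n ∷ᵛ m ∷ᵛ []ᵛ)))

  -- If z ≥ 6n, then depth at most 3 gives m > 2n, so the difference d ≤ 2n from the predecessor to
  -- z is itself in G, and `pair-bound` yields z + 3 ≤ 6n + 2.
  ∈G⇒<6n : ∀ {z} → z ∈ G → z < 6 * n
  ∈G⇒<6n z∈ = ≰⇒> λ 6n≤z →
    large z∈ 6n≤z (gapset-predecessor gap ≤2n z∈ (≤-trans 2≤6n 6n≤z))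
    where
    2≤6n : 2 ≤ 6 * n
    2≤6n = linear (4 * n) (1≤n ⊕ 1≤n) (solve (n ∷ᵛ []ᵛ))
    large : ∀ {z} → z ∈ G → 6 * n ≤ z →
            ∃[ p ] ∃[ d ] p ∈ G × 1 ≤ d × d ≤ 2 * n × p + d ≡ z → ⊥
    large z∈ 6n≤z (p , d , p∈ , 1≤d , d≤2n , refl) =
      1≰0 (linear 0 (bound ⊕ 6n≤z) (solve (p ∷ᵛ d ∷ᵛ n ∷ᵛ []ᵛ)))
      where
      d∈ : d ∈ G
      d∈ = initial⊆G isMultiplicity 1≤d
             (≤-trans (s≤s d≤2n) (3m-bound m (depth≤3⇒<3* q≤3 z∈) 6n≤z))
      -- Equality would give z ≤ 4n.
      p≢d : p ≢ d
      p≢d refl = 1≰0 (linear 1 (6n≤z ⊕ d≤2n ⊕ d≤2n ⊕ 1≤n ⊕ 1≤n) (solve (d ∷ᵛ n ∷ᵛ []ᵛ)))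
      bound : p + d + 3 ≤ 2 * (3 * n + 1)
      bound = subst (λ l → p + d + 3 ≤ 2 * l) length-G (pair-bound gap p∈ d∈ p≢d z∈ refl)

  2n≤m : 2 * n ≤ m
  2n≤m = ≮⇒≥ λ m<2n → m∉G (jump⇒initial {k = 2 * n} gap
    (λ a<x x<b → jump a<x (subst (_ <_) (sym b≡) x<b)) (subst (_∈ G) b≡ (hi⊆G (here refl))) 1≤m m<2n)

  -- As 2n ≥ 2, the number a + 1 lies inside the jump.
  m≤1+a : m ≤ suc a
  m≤1+a = proj₂ isMultiplicity (s≤s z≤n , jump (n<1+n a) 1+a<b)
    where
    1+a<b : suc a < b
    1+a<b = linear 0 (1≤n ⊕ 1≤n ⊕ a+2n≤b) (solve (a ∷ᵛ b ∷ᵛ n ∷ᵛ []ᵛ))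

  -- With m = 2n and a = 2n − 1 the predecessor p of 6n − 1 would be the sum
  -- of the two nongaps 2n and p − 2n.
  no-6n-1 : ∀ {z} → suc a ≤ 2 * n → m ≤ 2 * n → z ∈ b ∷ ys → b < z → 6 * n ≤ suc z → ⊥
  no-6n-1 _ _ (here refl) b<z _ = <-irrefl refl b<z
  no-6n-1 {z} a<2n m≤2n (there z∈) b<z 6n≤1+z = main (predecessor hi-increasing <2n z∈)
    where
    <2n : All (_< 2 * n) (differences (b ∷ ys))
    -- Here it matters that the jump is the last one: no difference above b equals 2n.
    <2n = All.zipWith (λ (d≤ , d≢) → ≤∧≢⇒< d≤ d≢)
            (proj₂ (proj₂ (All-jump⁻ xs a b ys ≤2n)) , ≢2n)

    2n≤p : ∀ {p d} → p + d ≡ z → d < 2 * n → 2 * n ≤ p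
    2n≤p {p} {d} refl d<2n = linear (2 * n) (6n≤1+z ⊕ d<2n) (solve (p ∷ᵛ d ∷ᵛ n ∷ᵛ []ᵛ))

    inJump : ∀ m → 2 * n ≤ m → m ≤ suc a → ∀ {q d} → 2 * n + q + d ≡ z → 1 ≤ d → d < 2 * n →
             a < q × q < b
    -- With z = 6n - 1, d < 2n gives q ≥ 2n > a, and d ≥ 1 gives q ≤ 4n - 2 < b.
    inJump m 2n≤m m≤1+a {q} {d} refl 1≤d d<2n =
        linear 0 (a<2n ⊕ 6n≤1+z ⊕ d<2n) (solve (a ∷ᵛ q ∷ᵛ d ∷ᵛ n ∷ᵛ []ᵛ))
      , linear 0 (∈G⇒<6n (hi⊆G (there z∈)) ⊕ 1≤d ⊕ a+2n≤b ⊕ m≤1+a ⊕ 2n≤m)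
                 (solve (a ∷ᵛ b ∷ᵛ q ∷ᵛ d ∷ᵛ n ∷ᵛ m ∷ᵛ []ᵛ))

    main : ∃[ p ] ∃[ d ] p ∈ b ∷ ys × 1 ≤ d × d < 2 * n × p + d ≡ z → ⊥
    main (p , d , p∈ , 1≤d , d<2n , eq) =
      [ (λ 2n∈ → m∉G (subst (_∈ G) (≤-antisym 2n≤m m≤2n) 2n∈))
      , (λ q∈ → let a<q , q<b = inJump m 2n≤m m≤1+a (trans (cong (_+ d) 2n+q≡p) eq) 1≤d d<2n
                in jump a<q q<b q∈)
      ]′ (gapset-covers gap (hi⊆G p∈) 2n+q≡p)
      where
      2n+q≡p : 2 * n + (p ∸ 2 * n) ≡ p
      2n+q≡p = m+[n∸m]≡n (2n≤p eq d<2n)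

  -- The elements 1, ..., m - 1 of G lie below the cut, so σ moves them to 2, ..., m and adds 1.
  ∉σG⇒m< : ∀ {x} → x ∉ σG → 1 ≤ x → m < x
  ∉σG⇒m< {suc zero}        x∉ _ = contradiction (∈shift⁺ {xs} one) x∉
  ∉σG⇒m< {suc x′@(suc _)} x∉ _ = s≤s (≮⇒≥ λ x′<m →
    let x′∈ = <b⇒∈lo (initial⊆G isMultiplicity (s≤s z≤n) x′<m)
                     (≤-<-trans (s≤s⁻¹ (≤-trans x′<m m≤1+a)) a<b)
    in x∉ (subst (_∈ σG) (+-comm x′ 1) (∈shift⁺ {xs} (below x′∈))))

  ∉σG⇒pred∉G : ∀ {x} → suc x ∉ σG → suc x ≤ b → x ∉ G
  ∉σG⇒pred∉G {x} x∉ x<b x∈ =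
    x∉ (subst (_∈ σG) (+-comm x 1) (∈shift⁺ {xs} (below (<b⇒∈lo x∈ x<b))))

  private
    -- Here z ≥ b + m = a + 2n + m. With z < 6n, m ≥ 2n and m ≤ a + 1 this leaves only m = 2n, a =
    -- 2n - 1, z = 6n - 1, the case that `no-6n-1` excludes.
    far′ : ∀ m → 1 ≤ m → 2 * n ≤ m → m ≤ suc a → ∀ {x y z} → z < 6 * n →
           b < x → m < y → x + y ≡ z + 2 →
           suc a ≤ 2 * n × m ≤ 2 * n × b < z × 6 * n ≤ suc z
    far′ m 1≤m 2n≤m m≤1+a {x} {y} {z} z<6n b<x m<y eq =
        linear 0 (b<x ⊕ m<y ⊕ x+y≤ ⊕ a+2n≤b ⊕ 2n≤m ⊕ z<6n)
            (solve (a ∷ᵛ b ∷ᵛ n ∷ᵛ m ∷ᵛ x ∷ᵛ y ∷ᵛ z ∷ᵛ []ᵛ))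
      , ≮⇒≥ (λ (2n<m : 2 * n < m) → 1≰0 (linear 1
          (b<x ⊕ m<y ⊕ x+y≤ ⊕ a+2n≤b ⊕ m≤1+a ⊕ z<6n ⊕ 2n<m ⊕ 2n<m)
              (solve (a ∷ᵛ b ∷ᵛ n ∷ᵛ m ∷ᵛ x ∷ᵛ y ∷ᵛ z ∷ᵛ []ᵛ))))
      , linear 0 (b<x ⊕ m<y ⊕ x+y≤ ⊕ 1≤m) (solve (a ∷ᵛ b ∷ᵛ n ∷ᵛ m ∷ᵛ x ∷ᵛ y ∷ᵛ z ∷ᵛ []ᵛ))
      , linear 0 (b<x ⊕ m<y ⊕ x+y≤ ⊕ a+2n≤b ⊕ m≤1+a ⊕ 2n≤m ⊕ 2n≤m)
          (solve (a ∷ᵛ b ∷ᵛ n ∷ᵛ m ∷ᵛ x ∷ᵛ y ∷ᵛ z ∷ᵛ []ᵛ))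
      where
      x+y≤ : x + y ≤ z + 2
      x+y≤ = ≤-reflexive eq

    -- Both summands exceed 2n, which forces a ≥ z ≥ 4n + 1 and hence b > 6n.
    low : ∀ m → 2 * n ≤ m → ∀ {x y z} → m < x → m < y → x + y ≡ z + 1 → z ≤ a → b < 6 * n → ⊥
    low m 2n≤m {x} {y} {z} m<x m<y eq z≤a b<6n = 1≰0 (linear 1
      (m<x ⊕ m<y ⊕ ≤-reflexive eq ⊕ z≤a ⊕ a+2n≤b ⊕ b<6n ⊕ 2n≤m ⊕ 2n≤m)
      (solve (a ∷ᵛ b ∷ᵛ n ∷ᵛ m ∷ᵛ x ∷ᵛ y ∷ᵛ z ∷ᵛ []ᵛ)))

  far : ∀ {x y z} → z ∈ b ∷ ys → b < x → m < y → x + y ≡ z + 2 → ⊥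
  far z∈ b<x m<y eq =
    let a<2n , m≤2n , b<z , 6n≤1+z = far′ m 1≤m 2n≤m m≤1+a (∈G⇒<6n (hi⊆G z∈)) b<x m<y eq
    in no-6n-1 a<2n m≤2n z∈ b<z 6n≤1+z

  -- Since z moves up by 2, taking 1 from each summand leaves z = (x - 1) + (y - 1) with neither
  -- summand in G.
  near : ∀ {x y z} → x ∉ σG → y ∉ σG → m < x → m < y → x ≤ b → y ≤ b →
         x + y ≡ z + 2 → z ∈ b ∷ ys → ⊥
  near {suc x} {suc y} {z} x∉ y∉ _ _ x≤b y≤b eq z∈ =
    [ ∉σG⇒pred∉G x∉ x≤b , ∉σG⇒pred∉G y∉ y≤b ]′ (gapset-covers gap (hi⊆G z∈)
      (+-cancelʳ-≡ 2 (x + y) z (trans eq′ eq)))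
    where
    eq′ : x + y + 2 ≡ suc x + suc y
    eq′ = solve (x ∷ᵛ y ∷ᵛ []ᵛ)

  uncovered : ∀ {x y z} → x ∉ σG → y ∉ σG → m < x → m < y → x + y ≡ z →
              ∈Shift (xs ++ [ a ]) (b ∷ ys) z → ⊥
  uncovered _ _ (s≤s {n = x} _) (s≤s {n = y} _) eq one =
    contradiction (trans (sym (+-suc x y)) (cong pred eq)) λ ()
  uncovered x∉ y∉ m<x m<y eq (below z∈) = low m 2n≤m m<x m<y eq (≤a z∈) (∈G⇒<6n (hi⊆G (here refl)))
  uncovered {x} {y} x∉ y∉ m<x m<y eq (above z∈) =
    [ (λ x≤b → [ (λ y≤b → near x∉ y∉ m<x m<y x≤b y≤b eq z∈)
               , (λ b<y → far z∈ b<y m<x (trans (+-comm y x) eq)) ]′ (≤-<-connex y b))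
    , (λ b<x → far z∈ b<x m<y eq)
    ]′ (≤-<-connex x b)

  σG-splits : ∀ {x y} → 1 ≤ x → 1 ≤ y → x + y ∈ σG → x ∈ σG ⊎ y ∈ σG
  σG-splits 1≤x 1≤y z∈ = ∈⊎∈ λ x∉ y∉ →
    uncovered x∉ y∉ (∉σG⇒m< x∉ 1≤x) (∉σG⇒m< y∉ 1≤y) refl (∈shift⁻ {xs} z∈)

  first≡1 : first xs a ≡ 1
  first≡1 = first-∷ xs (proj₂ (gapset-∷ gap (hi⊆G (here refl))))

  -- Both monotonicity and sparsity of σ(G) are read off its differences: those of G with one jump
  -- raised to 2n + 1 and a leading 1.
  All-σG : ∀ {P : Pred ℕ 0ℓ} → P 1 → All P (differences (xs ++ [ a ])) → P (2 * n + 1) →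
           All P (differences (b ∷ ys)) → All P (differences σG)
  All-σG {P} p₁ ps₁ p ps₂ = subst (All P) (sym (differences-shift xs a b ys))
    (Allₚ.++⁺ (subst P (sym first≡1) p₁ ∷ ps₁) (subst P (sym (shift-jump a b≡)) p ∷ ps₂))

  σG-gapset : IsGapset σG
  σG-gapset = record
    { increasing = positive⇒linked σG (All-σG ≤-refl (proj₁ pos) (m≤n+m 1 (2 * n)) (proj₂ (proj₂ pos)))
    ; positive   = All.tabulate λ z∈ → positive (∈shift⁻ {xs} z∈)
    ; splits     = σG-splits
    }
    where
    pos = All-jump⁻ xs a b ys (linked⇒positive (IsGapset.increasing gap))
    positive : ∀ {z} → ∈Shift (xs ++ [ a ]) (b ∷ ys) z → 1 ≤ z
    positive one           = ≤-refl
    positive (below {z} _) = m≤n+m 1 z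
    positive (above {z} _) = ≤-trans (s≤s z≤n) (m≤n+m 2 z)

  σG∈𝒢 : 𝒢 (2 * n + 1) (3 * n + 1 + 1) σG
  σG∈𝒢 = σG-gapset
       , trans (length-shift xs a b ys) (trans (cong suc length-G) (+-comm 1 (3 * n + 1)))
       , All-σG (m≤n+m 1 (2 * n)) (All.map weaken (proj₁ ≤2n′)) ≤-refl
           (All.map weaken (proj₂ (proj₂ ≤2n′)))
       , subst (Any (_≡ 2 * n + 1)) (sym (differences-shift xs a b ys))
           (Anyₚ.++⁺ʳ (first xs a ∷ differences (xs ++ [ a ])) (here (shift-jump a b≡)))
    where
    ≤2n′ = All-jump⁻ xs a b ys ≤2n
    weaken : ∀ {d} → d ≤ 2 * n → d ≤ 2 * n + 1
    weaken d≤ = ≤-trans d≤ (m≤m+n (2 * n) 1)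

  σG-not-pseudoSymmetric : ¬ PseudoSymmetric σG
  σG-not-pseudoSymmetric (_ , eq) =
    <-irrefl refl (bound (∈shift⁻ {xs} (max≡suc⇒∈ σG (trans max≡ (+-comm (6 * n) 2)))))
    where
    bound : ∀ {z} → ∈Shift (xs ++ [ a ]) (b ∷ ys) z → z < 2 + 6 * n
    bound one        = s≤s (s≤s z≤n)
    bound (below {z} z∈) = linear 1 (∈G⇒<6n (lo⊆G z∈)) (solve (z ∷ᵛ n ∷ᵛ []ᵛ))
    bound (above {z} z∈) = linear 0 (∈G⇒<6n (hi⊆G z∈)) (solve (z ∷ᵛ n ∷ᵛ []ᵛ))
    genus≡ : 2 * (3 * n + 1 + 1) ≡ 6 * n + 2 + 2
    genus≡ = solve (n ∷ᵛ []ᵛ)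
    -- The Frobenius number computes to `max 0 σG`, and 2g - 2 = 6n + 2 at genus 3n + 2.
    max≡ : max 0 σG ≡ 6 * n + 2
    max≡ = +-cancelʳ-≡ 2 (max 0 σG) (6 * n + 2)
      (trans eq (trans (cong (2 *_) (proj₁ (proj₂ σG∈𝒢))) genus≡))

-- Undoing σ at a jump

module Backward
  (n : ℕ) (1≤n : 1 ≤ n) (xs : List ℕ) (a b : ℕ) (ys : List ℕ)
  (gap′ : IsGapset (shift xs a b ys)) (length-G′ : length (shift xs a b ys) ≡ 3 * n + 1 + 1)
  (b≡ : b ≡ a + 2 * n)
  (positive : All (1 ≤_) (xs ++ a ∷ b ∷ ys))
  (initial : ∀ {i} → 1 ≤ i → i ≤ 2 * n → i ∈ shift xs a b ys)
  (bound : ∀ {z} → z ∈ shift xs a b ys → z ≤ 6 * n + 1)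
  (≤2n : All (_≤ 2 * n) (differences (xs ++ [ a ])))
  where

  G′ : List ℕ
  G′ = shift xs a b ys

  a+2n≤b : a + 2 * n ≤ b
  a+2n≤b = ≤-reflexive (sym b≡)

  2n≤b : 2 * n ≤ b
  2n≤b = ≤-trans (m≤n+m (2 * n) a) a+2n≤b

  b∸a≡2n : b ∸ a ≡ 2 * n
  b∸a≡2n = trans (cong (_∸ a) b≡) (m+n∸m≡n a (2 * n))

  increasing : Linked _<_ (xs ++ a ∷ b ∷ ys)
  increasing = positive⇒linked (xs ++ a ∷ b ∷ ys)
    (All-jump⁺ xs a b ys (All.tail (proj₁ positive′))
      (subst (1 ≤_) (sym b∸a≡2n) 1≤2n) (proj₂ positive′))
    where
    1≤2n : 1 ≤ 2 * n
    1≤2n = ≤-trans 1≤n (m≤m+n n (1 * n))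
    positive′ : All (1 ≤_) (first xs a ∷ differences (xs ++ [ a ])) × All (1 ≤_) (differences (b ∷ ys))
    positive′ = let p , q = Allₚ.++⁻ (first xs a ∷ differences (xs ++ [ a ]))
                              (subst (All (1 ≤_)) (differences-shift xs a b ys)
                                (linked⇒positive (IsGapset.increasing gap′)))
                in p , All.tail q

  open Jump {xs} {a} {b} {ys} increasing

  jump′ : ∀ {z} → suc a < z → z ≤ suc b → z ∉ G′
  jump′ 1+a<z z≤1+b z∈ = cases 1+a<z z≤1+b (∈shift⁻ {xs} z∈)
    where
    cases : ∀ {z} → suc a < z → z ≤ suc b → ∈Shift (xs ++ [ a ]) (b ∷ ys) z → ⊥
    cases 1+a<1 _ one = n≮0 (s≤s⁻¹ 1+a<1)
    cases 1+a<z z≤1+b (below {z} z∈) =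
      1≰0 (linear 0 (1+a<z ⊕ ≤a z∈) (solve (a ∷ᵛ z ∷ᵛ []ᵛ)))
    cases 1+a<z z≤1+b (above {z} z∈) =
      1≰0 (linear 0 (z≤1+b ⊕ b≤ z∈) (solve (b ∷ᵛ z ∷ᵛ []ᵛ)))

  -- Otherwise a + 2 ≤ 2n would be an initial element of G′ inside its jump from a + 1 to b + 2.
  2n≤1+a : 2 * n ≤ suc a
  2n≤1+a = ≮⇒≥ λ 1+a<2n → jump′ ≤-refl 1+a≤b (initial (s≤s z≤n) 1+a<2n)
    where
    1+a≤b : suc (suc a) ≤ suc b
    1+a≤b = s≤s a<b

  -- In G′ the value x + 1 could come only from x: it is larger than 1, and everything moved by 2 is
  -- at least b + 2.
  ∉G⇒suc∉G′ : ∀ {x} → 1 ≤ x → x ∉ G → x < b → suc x ∉ G′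
  ∉G⇒suc∉G′ {x} 1≤x x∉ x<b z∈ = cases refl (∈shift⁻ {xs} z∈)
    where
    cases : ∀ {z} → z ≡ suc x → ∈Shift (xs ++ [ a ]) (b ∷ ys) z → ⊥
    cases eq one = 1≰0 (subst (1 ≤_) (suc-injective (sym eq)) 1≤x)
    cases eq (below {z} z∈) = x∉ (subst (_∈ G) (suc-injective (trans (+-comm 1 z) eq)) (lo⊆G z∈))
    cases eq (above {z} z∈) = <⇒≱ x<b
      (≤-trans (b≤ z∈) (≤-trans (n≤1+n z) (≤-reflexive (suc-injective (trans (+-comm 2 z) eq)))))

  ∉G⇒2n≤ : ∀ {x} → 1 ≤ x → x ∉ G → 2 * n ≤ x
  ∉G⇒2n≤ 1≤x x∉ = ≮⇒≥ λ x<2n →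
    ∉G⇒suc∉G′ 1≤x x∉ (≤-trans x<2n 2n≤b) (initial (s≤s z≤n) x<2n)

  -- Two uncovered summands are at least 2n. If x + y ≤ a, then b + 2 exceeds 6n + 1; if a summand
  -- exceeds b, then x + y + 2 does. Otherwise x + 1 and y + 1 are missing from G′, although their
  -- sum x + y + 2 is in it.
  splits : ∀ {x y} → 1 ≤ x → 1 ≤ y → x + y ∈ G → x ∈ G ⊎ y ∈ G
  splits 1≤x 1≤y z∈ = ∈⊎∈ λ x∉ y∉ →
    [ low (∉G⇒2n≤ 1≤x x∉) (∉G⇒2n≤ 1≤y y∉) , high 1≤x 1≤y x∉ y∉ ]′ (lo⊎hi z∈)
    where
    b+2≤ : b + 2 ≤ 6 * n + 1
    b+2≤ = bound (∈shift⁺ {xs} (above (here refl)))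

    low : ∀ {x y} → 2 * n ≤ x → 2 * n ≤ y → x + y ∈ xs ++ [ a ] → ⊥
    low {x} {y} 2n≤x 2n≤y z∈ = 1≰0 (linear 0 (2n≤x ⊕ 2n≤y ⊕ ≤a z∈ ⊕ a+2n≤b ⊕ b+2≤)
      (solve (a ∷ᵛ b ∷ᵛ n ∷ᵛ x ∷ᵛ y ∷ᵛ []ᵛ)))

    far : ∀ {x y} → b < x → 2 * n ≤ y → x + y ∈ b ∷ ys → ⊥
    far {x} {y} b<x 2n≤y z∈ = 1≰0 (linear 0
      (b<x ⊕ 2n≤y ⊕ bound (∈shift⁺ {xs} (above z∈)) ⊕ a+2n≤b ⊕ 2n≤1+a)
      (solve (a ∷ᵛ b ∷ᵛ n ∷ᵛ x ∷ᵛ y ∷ᵛ []ᵛ)))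

    near : ∀ {x y} → suc x ∉ G′ → suc y ∉ G′ → x + y ∈ b ∷ ys → ⊥
    near {x} {y} x∉ y∉ z∈ =
      [ x∉ , y∉ ]′ (gapset-covers gap′ (∈shift⁺ {xs} (above z∈)) eq)
      where
      eq : suc x + suc y ≡ x + y + 2
      eq = solve (x ∷ᵛ y ∷ᵛ []ᵛ)

    ∉G⇒<b⊎b< : ∀ {x} → x ∉ G → x < b ⊎ b < x
    ∉G⇒<b⊎b< {x} x∉ = ⊎.map₂ (λ b≤x → ≤∧≢⇒< b≤x λ { refl → x∉ (hi⊆G (here refl)) }) (<-≤-connex x b)

    high : ∀ {x y} → 1 ≤ x → 1 ≤ y → x ∉ G → y ∉ G → x + y ∈ b ∷ ys → ⊥
    high {x} {y} 1≤x 1≤y x∉ y∉ z∈ =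
      [ (λ x<b → [ (λ y<b → near (∉G⇒suc∉G′ 1≤x x∉ x<b) (∉G⇒suc∉G′ 1≤y y∉ y<b) z∈)
                 , (λ b<y → far b<y (∉G⇒2n≤ 1≤x x∉) (subst (_∈ b ∷ ys) (+-comm x y) z∈))
                 ]′ (∉G⇒<b⊎b< y∉))
      , (λ b<x → far b<x (∉G⇒2n≤ 1≤y y∉) z∈)
      ]′ (∉G⇒<b⊎b< x∉)

  -- A difference of at least 2n above b would force 6n + 1 into G′, but
  -- 6n + 1 = (2n + 1) + 4n with both summands inside the jump.
  <2n : All (_< 2 * n) (differences (b ∷ ys))
  <2n = All-differences (b ∷ ys) hi-increasing λ {x} {y} x∈ y∈ x<y → ≰⇒> λ 2n≤y∸x →
    absurd (b≤ x∈) y∈ (≤-trans (+-monoʳ-≤ x 2n≤y∸x) (≤-reflexive (m+[n∸m]≡n (<⇒≤ x<y))))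
    where
    absurd : ∀ {x y} → b ≤ x → y ∈ b ∷ ys → x + 2 * n ≤ y → ⊥
    absurd {x} {y} b≤x y∈ x+2n≤y =
      [ jump′ (s≤s 1+a≤2n) 2n+1≤1+b , jump′ 1+a<4n 4n≤1+b ]′
        (gapset-covers gap′ (∈shift⁺ {xs} (above y∈)) eq)
      where
      y+2≤ : y + 2 ≤ 6 * n + 1
      y+2≤ = bound (∈shift⁺ {xs} (above y∈))
      -- From a + 4n ≤ y ≤ 6n - 1 and 2n ≤ a + 1 follow a = 2n - 1 and y + 2 = 6n + 1; the jump of
      -- G′ then runs from 2n to 4n + 1.
      1+a≤2n : suc a ≤ 2 * n
      1+a≤2n = linear 0 (b≤x ⊕ x+2n≤y ⊕ y+2≤ ⊕ a+2n≤b) (solve (a ∷ᵛ b ∷ᵛ n ∷ᵛ x ∷ᵛ y ∷ᵛ []ᵛ))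
      6n+1≤ : suc (2 * n) + 4 * n ≤ y + 2
      6n+1≤ = linear 0 (b≤x ⊕ x+2n≤y ⊕ a+2n≤b ⊕ 2n≤1+a) (solve (a ∷ᵛ b ∷ᵛ n ∷ᵛ x ∷ᵛ y ∷ᵛ []ᵛ))
      6n+1≥ : y + 2 ≤ suc (2 * n) + 4 * n
      6n+1≥ = linear 0 y+2≤ (solve (n ∷ᵛ y ∷ᵛ []ᵛ))
      eq : suc (2 * n) + 4 * n ≡ y + 2
      eq = ≤-antisym 6n+1≤ 6n+1≥
      2n+1≤1+b : suc (2 * n) ≤ suc b
      2n+1≤1+b = s≤s 2n≤b
      1+a<4n : suc (suc a) ≤ 4 * n
      1+a<4n = linear 1 (1+a≤2n ⊕ 1≤n ⊕ 1≤n) (solve (a ∷ᵛ n ∷ᵛ []ᵛ))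
      4n≤1+b : 4 * n ≤ suc b
      4n≤1+b = linear 0 (a+2n≤b ⊕ 2n≤1+a) (solve (a ∷ᵛ b ∷ᵛ n ∷ᵛ []ᵛ))

  ∈G⇒<6n : ∀ {z} → z ∈ G → z < 6 * n
  ∈G⇒<6n z∈ =
    [ (λ z∈lo → <-trans (≤-<-trans (≤a z∈lo) a<b) (hi<6n (here refl))) , hi<6n ]′ (lo⊎hi z∈)
    where
    hi<6n : ∀ {z} → z ∈ b ∷ ys → z < 6 * n
    hi<6n {z} z∈ = linear 0 (bound (∈shift⁺ {xs} (above z∈))) (solve (n ∷ᵛ z ∷ᵛ []ᵛ))

  -- All elements are below 6n, so the conductor is at most 6n ≤ 3m.
  depth-G : depth G ≤ 3
  depth-G = conductor≤3*⇒depth≤3 {G} (≤-trans conductor≤6n (6n≤3m (multiplicity G) 2n≤m))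
    where
    conductor≤6n : conductor G ≤ 6 * n
    conductor≤6n = max<v⁺ (≤-<-trans z≤n (∈G⇒<6n a∈G)) (All.tabulate ∈G⇒<6n)
      where a∈G = lo⊆G a∈lo
    2n≤m : 2 * n ≤ multiplicity G
    2n≤m = let (1≤m , m∉) , _ = proj₂ (hasMultiplicity G) in ∉G⇒2n≤ 1≤m m∉
    6n≤3m : ∀ m → 2 * n ≤ m → 6 * n ≤ 3 * m
    6n≤3m m 2n≤m = linear 0 (2n≤m ⊕ 2n≤m ⊕ 2n≤m) (solve (n ∷ᵛ m ∷ᵛ []ᵛ))

  G∈𝒢 : 𝒢[ 2 * n , 3 * n + 1 ,q≤3] G
  G∈𝒢 = ( record { increasing = increasing ; positive = positive ; splits = splits }
        , length-G
        , All-jump⁺ xs a b ys ≤2n (≤-reflexive b∸a≡2n) (All.map <⇒≤ <2n)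
        , subst (Any (_≡ 2 * n)) (sym (differences-++ xs a b ys))
            (Anyₚ.++⁺ʳ (differences (xs ++ [ a ])) (here b∸a≡2n)) )
        , depth-G
    where
    length-G : length G ≡ 3 * n + 1
    length-G = suc-injective (trans (sym (length-shift xs a b ys))
                 (trans length-G′ (+-comm (3 * n + 1) 1)))

  -- By `<2n` no 2n-jump follows b, so the chosen cut is the one that σ makes.
  σG≡G′ : σ n G ≡ G′
  σG≡G′ = σ-lastJump n xs a b ys b∸a≡2n (All.map <⇒≢ <2n)

-- Writing a gapset as a shift

unshift : ∀ k {xs} → All (k <_) xs → ∃[ ys ] xs ≡ map (_+ k) ys × All (1 ≤_) ys
unshift k [] = [] , refl , []
unshift k {x ∷ _} (k<x ∷ k<xs) with unshift k k<xs
... | ys , refl , pos = x ∸ k ∷ ys , cong (_∷ _) (sym (m∸n+n≡m (<⇒≤ k<x))) , m<n⇒0<n∸m k<x ∷ pos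

-- The indices follow `shift-++`; matching replaces all four pieces of the cut by their shifted
-- forms at once.
data Shifted : List ℕ → ℕ → ℕ → List ℕ → Set where
  shifted : ∀ xs a b ys → All (1 ≤_) (xs ++ a ∷ b ∷ ys) →
            Shifted (1 ∷ map (_+ 1) xs) (a + 1) (b + 2) (map (_+ 2) ys)

-- As a ≥ 2, the leading 1 comes before a. The other entries up to a exceed 1 and those from b on
-- exceed 2, so subtracting 1 and 2 leaves positive numbers.
jump⇒shifted : ∀ xs {a b ys} → IsGapset (xs ++ a ∷ b ∷ ys) → 2 ≤ a → Shifted xs a b ys
jump⇒shifted xs {a} {b} {ys} gap 2≤a = head-1 xs gap (proj₂ (gapset-∷ gap (J.hi⊆G (here refl)))) 2<
  where
  module J = Jump {xs} {a} {b} {ys} (IsGapset.increasing gap)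
  2< : All (2 <_) (b ∷ ys)
  2< = All.tabulate λ z∈ → ≤-trans (≤-<-trans 2≤a J.a<b) (J.b≤ z∈)
  head-1 : ∀ xs {zs} → IsGapset (xs ++ a ∷ b ∷ ys) → xs ++ a ∷ b ∷ ys ≡ 1 ∷ zs →
           All (2 <_) (b ∷ ys) → Shifted xs a b ys
  head-1 [] _ refl _ = contradiction 2≤a λ { (s≤s ()) }
  head-1 (_ ∷ xs) gap refl 2<
    with unshift 1 (Allₚ.++⁻ˡ xs (AllPairs.head (Linked⇒AllPairs <-trans (IsGapset.increasing gap))))
       | unshift 1 (2≤a ∷ []) | unshift 2 2<
  ... | xs′ , refl , pos₁ | a′ ∷ [] , refl , pos₂ ∷ [] | b′ ∷ ys′ , refl , pos₃ =
    shifted xs′ a′ b′ ys′ (Allₚ.++⁺ pos₁ (pos₂ ∷ pos₃))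

-- Bounding a gapset with a (2n+1)-jump

module BackwardBound
  (n : ℕ) (1≤n : 1 ≤ n) (xs : List ℕ) (a b : ℕ) (ys : List ℕ)
  (gap : IsGapset (xs ++ a ∷ b ∷ ys)) (length-G : length (xs ++ a ∷ b ∷ ys) ≡ 3 * n + 1 + 1)
  (b∸a≡ : b ∸ a ≡ 2 * n + 1)
  (≤2n+1 : All (_≤ 2 * n + 1) (differences (xs ++ a ∷ b ∷ ys)))
  (not-pseudoSymmetric : ¬ PseudoSymmetric (xs ++ a ∷ b ∷ ys))
  where

  open Jump {xs} {a} {b} {ys} (IsGapset.increasing gap)

  b≡ : b ≡ a + (2 * n + 1)
  b≡ = sym (trans (cong (a +_) (sym b∸a≡)) (m+[n∸m]≡n (<⇒≤ a<b)))

  initial : ∀ {i} → 1 ≤ i → i ≤ 2 * n → i ∈ G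
  initial 1≤i i≤2n = jump⇒initial {k = 2 * n + 1} gap
    (λ a<x x<b → jump a<x (subst (_ <_) (sym b≡) x<b)) (subst (_∈ G) b≡ (hi⊆G (here refl)))
    1≤i (≤-trans (s≤s i≤2n) (≤-reflexive (+-comm 1 (2 * n))))

  2n≤a : 2 * n ≤ a
  2n≤a = ≮⇒≥ λ a<2n → jump (n<1+n a) 1+a<b (initial (s≤s z≤n) a<2n)
    where
    1+a<b : suc a < b
    1+a<b = linear 1 (1≤n ⊕ 1≤n ⊕ ≤-reflexive (sym b≡)) (solve (a ∷ᵛ b ∷ᵛ n ∷ᵛ []ᵛ))

  -- This is the extreme value 2g - 1. The difference d from its predecessor p lies in G, so
  -- `pair-bound` would give z + 3 ≤ 6n + 4.
  no-6n+3 : ∀ {z} → z ∈ G → z ≡ 6 * n + 3 → ⊥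
  no-6n+3 {z} z∈ z≡ = main (gapset-predecessor gap ≤2n+1 z∈ 1<z)
    where
    1<z : 1 < z
    1<z = subst (1 <_) (sym z≡) (≤-trans (s≤s (s≤s z≤n)) (m≤n+m 3 (6 * n)))
    main : ∃[ p ] ∃[ d ] p ∈ G × 1 ≤ d × d ≤ 2 * n + 1 × p + d ≡ z → ⊥
    main (p , d , p∈ , 1≤d , d≤ , eq) = 1≰0 (linear 1 (6n+6≤ ⊕ ≤-reflexive (sym z≡))
        (solve (n ∷ᵛ z ∷ᵛ []ᵛ)))
      where
      z≤ : 6 * n + 3 ≤ p + d
      z≤ = ≤-reflexive (trans (sym z≡) (sym eq))
      d∈ : d ∈ G
      d∈ = [ (λ d<2n+1 → initial 1≤d (s≤s⁻¹ (≤-trans d<2n+1 (≤-reflexive (+-comm (2 * n) 1)))))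
           -- For d = 2n + 1 the predecessor is 4n + 2 = 2 (2n + 1), and splitting it in halves puts
           -- 2n + 1 into G.
           , (λ { refl → [ id , id ]′ (gapset-covers gap p∈ (halves p eq)) })
           ]′ (m≤n⇒m<n∨m≡n d≤)
        where
        halves : ∀ p → p + (2 * n + 1) ≡ z → (2 * n + 1) + (2 * n + 1) ≡ p
        halves p eq = +-cancelʳ-≡ (2 * n + 1) _ p (trans triple (trans (sym z≡) (sym eq)))
          where
          triple : (2 * n + 1) + (2 * n + 1) + (2 * n + 1) ≡ 6 * n + 3
          triple = solve (n ∷ᵛ []ᵛ)
      p≢d : p ≢ d
      p≢d refl = 1≰0 (linear (2 * n) (z≤ ⊕ d≤ ⊕ d≤) (solve (d ∷ᵛ n ∷ᵛ []ᵛ)))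
      6n+6≤ : z + 3 ≤ 2 * (3 * n + 1 + 1)
      6n+6≤ = subst (λ l → z + 3 ≤ 2 * l) length-G (pair-bound gap p∈ d∈ p≢d z∈ eq)

  -- `gapset-bound` leaves a maximum of at most 6n + 3; that value is excluded by `no-6n+3`, and 6n
  -- + 2 = 2g - 2 would be pseudo-symmetry.
  bound : ∀ {z} → z ∈ G → z ≤ 6 * n + 1
  bound z∈ = ≤-trans (All.lookup (xs≤max 0 G) z∈) (max-bound (max 0 G) refl)
    where
    max-bound : ∀ k → max 0 G ≡ k → k ≤ 6 * n + 1
    max-bound zero    _   = z≤n
    max-bound (suc k) max≡ = ≮⇒≥ λ 6n+1<k →
      [ (λ 6n+2<k → no-6n+3 k∈ (≤-antisym k≤ (6n+3≤ 6n+2<k)))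
      , (λ 6n+2≡k → not-pseudoSymmetric (gap , pseudo (trans max≡ (sym 6n+2≡k))))
      ]′ (m≤n⇒m<n∨m≡n 6n+1<k)
      where
      k∈ : suc k ∈ G
      k∈ = max≡suc⇒∈ G max≡
      k≤ : suc k ≤ 6 * n + 3
      k≤ = linear 0 (subst (λ l → suc (suc k) ≤ 2 * l) length-G (gapset-bound gap k∈))
          (solve (k ∷ᵛ n ∷ᵛ []ᵛ))
      6n+3≤ : suc (6 * n + 1) < suc k → 6 * n + 3 ≤ suc k
      6n+3≤ lt = linear 0 lt (solve (k ∷ᵛ n ∷ᵛ []ᵛ))
      pseudo : max 0 G ≡ suc (6 * n + 1) → max 0 G + 2 ≡ 2 * length G
      pseudo eq = trans (cong (_+ 2) eq) (trans genus≡ (cong (2 *_) (sym length-G)))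
        where
        genus≡ : suc (6 * n + 1) + 2 ≡ 2 * (3 * n + 1 + 1)
        genus≡ = solve (n ∷ᵛ []ᵛ)

-- The two inclusions

image⊆ : ∀ n → 1 ≤ n → ∀ G → 𝒢[ 2 * n , 3 * n + 1 ,q≤3] G →
         𝒢 (2 * n + 1) (3 * n + 1 + 1) (σ n G) × ¬ PseudoSymmetric (σ n G)
image⊆ n 1≤n G ((gap , len , ≤2n , any) , q≤3) = at gap len ≤2n q≤3 (lastJump (2 * n) G any)
  where
  at : ∀ {G} → IsGapset G → length G ≡ 3 * n + 1 → All (_≤ 2 * n) (differences G) → depth G ≤ 3 →
       LastJump (2 * n) G → 𝒢 (2 * n + 1) (3 * n + 1 + 1) (σ n G) × ¬ PseudoSymmetric (σ n G)
  at gap len ≤2n q≤3 (xs , a , b , ys , refl , b∸a≡ , ≢2n) =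
    subst (λ G′ → 𝒢 (2 * n + 1) (3 * n + 1 + 1) G′ × ¬ PseudoSymmetric G′)
      (sym (σ-lastJump n xs a b ys b∸a≡ ≢2n))
      ( Forward.σG∈𝒢 n 1≤n xs a b ys gap len b≡ ≤2n ≢2n q≤3
      , Forward.σG-not-pseudoSymmetric n 1≤n xs a b ys gap len b≡ ≤2n ≢2n q≤3 )
    where
    b≡ : b ≡ a + 2 * n
    b≡ = sym (trans (cong (a +_) (sym b∸a≡))
           (m+[n∸m]≡n (<⇒≤ (Jump.a<b {xs} {a} {b} {ys} (IsGapset.increasing gap)))))

preimage : ∀ n → 1 ≤ n → ∀ {xs a b ys} (let G′ = xs ++ a ∷ b ∷ ys) → Shifted xs a b ys →
  IsGapset G′ →
  length G′ ≡ 3 * n + 1 + 1 → All (_≤ 2 * n + 1) (differences (xs ++ [ a ])) →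
  All (_≢ 2 * n + 1) (differences (xs ++ [ a ])) → b ≡ a + (2 * n + 1) →
  (∀ {i} → 1 ≤ i → i ≤ 2 * n → i ∈ G′) → (∀ {z} → z ∈ G′ → z ≤ 6 * n + 1) →
  ∃[ G ] 𝒢[ 2 * n , 3 * n + 1 ,q≤3] G × σ n G ≡ G′
preimage n 1≤n (shifted xs a b ys pos) gap len ≤2n+1 ≢2n+1 b≡ initial bound =
  xs ++ a ∷ b ∷ ys , G∈𝒢 , trans σG≡G′ eq
  where
  eq = shift-++ xs a b ys

  a+1+2n+1≡ : a + 1 + (2 * n + 1) ≡ a + 2 * n + 2
  a+1+2n+1≡ = solve (a ∷ᵛ n ∷ᵛ []ᵛ)

  b≡′ : b ≡ a + 2 * n
  b≡′ = +-cancelʳ-≡ 2 b (a + 2 * n) (trans b≡ a+1+2n+1≡)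

  initial′ : ∀ {i} → 1 ≤ i → i ≤ 2 * n → i ∈ shift xs a b ys
  initial′ {i} 1≤i i≤2n = subst (i ∈_) (sym eq) (initial 1≤i i≤2n)

  bound′ : ∀ {z} → z ∈ shift xs a b ys → z ≤ 6 * n + 1
  bound′ {z} z∈ = bound (subst (z ∈_) eq z∈)

  ≤2n : All (_≤ 2 * n) (first xs a ∷ differences (xs ++ [ a ]))
  -- The cut is at the first (2n+1)-jump, so every difference below it is at most 2n.
  ≤2n = subst (All (_≤ 2 * n)) (differences-lower xs a)
    (All.zipWith (λ (d≤ , d≢) → s≤s⁻¹ (≤-trans (≤∧≢⇒< d≤ d≢) (≤-reflexive (+-comm (2 * n) 1))))
                 (≤2n+1 , ≢2n+1))

  gap′ : IsGapset (shift xs a b ys)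
  gap′ = subst IsGapset (sym eq) gap

  len′ : length (shift xs a b ys) ≡ 3 * n + 1 + 1
  len′ = trans (cong length eq) len

  G∈𝒢 : 𝒢[ 2 * n , 3 * n + 1 ,q≤3] (xs ++ a ∷ b ∷ ys)
  G∈𝒢 = Backward.G∈𝒢 n 1≤n xs a b ys gap′ len′ b≡′ pos initial′ bound′ (All.tail ≤2n)

  σG≡G′ : σ n (xs ++ a ∷ b ∷ ys) ≡ shift xs a b ys
  σG≡G′ = Backward.σG≡G′ n 1≤n xs a b ys gap′ len′ b≡′ pos initial′ bound′ (All.tail ≤2n)

⊆image : ∀ n → 1 ≤ n → ∀ G′ → 𝒢 (2 * n + 1) (3 * n + 1 + 1) G′ → ¬ PseudoSymmetric G′ →
         ∃[ G ] 𝒢[ 2 * n , 3 * n + 1 ,q≤3] G × σ n G ≡ G′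
⊆image n 1≤n G′ (gap , len , ≤2n+1 , any) ¬ps = at gap len ≤2n+1 ¬ps (firstJump (2 * n + 1) G′ any)
  where
  at : ∀ {G′} → IsGapset G′ → length G′ ≡ 3 * n + 1 + 1 → All (_≤ 2 * n + 1) (differences G′) →
       ¬ PseudoSymmetric G′ → FirstJump (2 * n + 1) G′ →
       ∃[ G ] 𝒢[ 2 * n , 3 * n + 1 ,q≤3] G × σ n G ≡ G′
  at gap len ≤2n+1 ¬ps (xs , a , b , ys , refl , b∸a≡ , ≢2n+1) =
    preimage n 1≤n (jump⇒shifted xs gap 2≤a) gap len (proj₁ (All-jump⁻ xs a b ys ≤2n+1)) ≢2n+1
      (BackwardBound.b≡ n 1≤n xs a b ys gap len b∸a≡ ≤2n+1 ¬ps)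
      (BackwardBound.initial n 1≤n xs a b ys gap len b∸a≡ ≤2n+1 ¬ps)
      (BackwardBound.bound n 1≤n xs a b ys gap len b∸a≡ ≤2n+1 ¬ps)
    where
    2n≤a : 2 * n ≤ a
    2n≤a = BackwardBound.2n≤a n 1≤n xs a b ys gap len b∸a≡ ≤2n+1 ¬ps
    2≤a : 2 ≤ a
    2≤a = linear 0 (1≤n ⊕ 1≤n ⊕ 2n≤a) (solve (a ∷ᵛ n ∷ᵛ []ᵛ))

mainTheorem2 : ∀ (n : ℕ) .{{_ : NonZero n}} →
    let g = 3 * n + 1
        σ[𝒢] = Image (σ n) 𝒢[ 2 * n , g ,q≤3]
    in Empty (σ[𝒢] ∩ PseudoSymmetric)
       × (σ[𝒢] ≐ 𝒢 (2 * n + 1) (g + 1) ∖ 𝒫 (2 * n + 1) (g + 1))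
mainTheorem2 n =
    (λ { _ ((G , G∈ , refl) , ps) → proj₂ (image⊆ n 1≤n G G∈) ps })
  , (λ { (G , G∈ , refl) → let σG∈ , ¬ps = image⊆ n 1≤n G G∈ in σG∈ , ¬ps ∘ proj₂ })
  , (λ { {G′} (G′∈ , ∉𝒫) → ⊆image n 1≤n G′ G′∈ (λ ps → ∉𝒫 (G′∈ , ps)) })
  where
  1≤n : 1 ≤ n
  1≤n = >-nonZero⁻¹ n
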